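{- For every positive integer $N$ there exists a connected graph $G$ with finite multiset dimension $\mathrm{md}(G)$ and finite multiset partition dimension $\mathrm{mpd}(G)$ such that $|\mathrm{mpd}(G)-\mathrm{md}(G)|\ge N$.
   Context: Graphs are finite, simple and undirected; $d(u,v)$ denotes the shortest-path distance. Let $G$ be a connected graph. Multiset dimension (also called multiset metric dimension): for $W\subseteq V(G)$ and $v\in V(G)$ let $r_m(v\mid W)=\{d(v,w):w\in W\}$, considered as a multiset. $W$ is a multiset resolving set if $r_m(u\mid W)\ne r_m(v\mid W)$ for all distinct $u,v\in V(G)$. $\mathrm{md}(G)$ is the minimum cardinality of a multiset resolving set, and is infinite if none exists. Multiset partition dimension: let $\Pi=\{S_1,\dots,S_t\}$ be a partition of $V(G)$ into nonempty parts. For $v\in V(G)$ put $d(v,S_i)=\min\{d(v,x):x\in S_i\}$ and let $r_{mp}(v\mid\Pi)$ be the multiset $\{d(v,S_1),\dots,d(v,S_t)\}$. $\Pi$ is a resolving multiset partition if $r_{mp}(u\mid\Pi)\ne r_{mp}(v\mid\Pi)$ for all distinct $u,v\in V(G)$. $\mathrm{mpd}(G)$ is the minimum number $t$ of parts of a resolving multiset partition of $G$, and $\mathrm{mpd}(G)=\infty$ if none exists. -}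

module Defs where

open import Data.Fin.Base using (Fin)
open import Data.Fin.Properties using (any?; _≟_)
open import Data.Fin.Subset using (Subset; _∈_; Nonempty; ∣_∣)
open import Data.Fin.Subset.Properties using (_∈?_)
open import Data.List.Base using (List; allFin; filter; map; tabulate)
open import Data.List.Extrema.Nat using (min)
open import Data.List.Relation.Binary.Permutation.Propositional using (_↭_)
open import Data.Nat.Base using (ℕ; zero; suc; _≤_; z≤n; s≤s)
open import Data.Product using (∃!)
open import Data.Product.Base using (Σ; ∃; _×_; _,_; proj₁; proj₂)
open import Level using (0ℓ)
open import Relation.Binary.Core using (Rel)
open import Relation.Binary.Definitions using (Symmetric; Irreflexive; Decidable)
open import Relation.Binary.PropositionalEquality using (_≡_; _≢_; refl)
open import Relation.Nullary using (¬_; yes; no; contradiction)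
open import Relation.Nullary.Decidable using (map′; _×-dec_)
import Relation.Unary as U

IsLeast : (ℕ → Set) → ℕ → Set
IsLeast P m = P m × (∀ k → P k → m ≤ k)

least : {P : ℕ → Set} → U.Decidable P → ∃ P → ∃ (IsLeast P)
least {P} P? (b , pb) = search P P? b pb
  where
  search : (Q : ℕ → Set) → U.Decidable Q → ∀ b → Q b → ∃ (IsLeast Q)
  search Q Q? zero    q = zero , q , λ _ _ → z≤n
  search Q Q? (suc b) q with Q? zero
  ... | yes q₀ = zero , q₀ , λ _ _ → z≤n
  ... | no ¬q₀ with search (λ k → Q (suc k)) (λ k → Q? (suc k)) b q
  ...   | m , qm , m≤ = suc m , qm , λ where
            zero    q₀ → contradiction q₀ ¬q₀
            (suc k) qk → s≤s (m≤ k qk)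

-- Decidability of adjacency is automatic classically; here it is what makes
-- distances computable.
record Graph (n : ℕ) : Set₁ where
  field
    Adj    : Rel (Fin n) 0ℓ
    adj?   : Decidable Adj
    sym    : Symmetric Adj
    irrefl : Irreflexive _≡_ Adj

module _ {n : ℕ} (G : Graph n) where
  open Graph G

  infixr 5 _∷_

  -- A walk of least length is a path, so least walk length is shortest-path
  -- distance.
  data Walk : Fin n → Fin n → ℕ → Set where
    []  : ∀ {u} → Walk u u zero
    _∷_ : ∀ {u v w k} → Adj u v → Walk v w k → Walk u w (suc k)

  -- The graph without vertices is not counted as connected.
  Connected : Set
  Connected = Fin n × (∀ u v → ∃ (Walk u v))

  walk? : ∀ u v → U.Decidable (Walk u v)
  walk? u v zero    = map′ (λ { refl → [] }) (λ { [] → refl }) (u ≟ v)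
  walk? u v (suc k) = map′ (λ { (_ , a , p) → a ∷ p }) (λ { (a ∷ p) → _ , a , p })
                           (any? (λ x → adj? u x ×-dec walk? x v k))

members : ∀ {n} → Subset n → List (Fin n)
members {n} S = filter (_∈? S) (allFin n)

record IsPartition {n t : ℕ} (S : Fin t → Subset n) : Set where
  field
    nonempty : ∀ i → Nonempty (S i)
    unique   : ∀ v → ∃! _≡_ (λ i → v ∈ S i)

-- Multisets of naturals are lists compared up to permutation _↭_.
module _ {n : ℕ} (G : Graph n) (conn : Connected G) where

  shortest : ∀ u v → ∃ (IsLeast (Walk G u v))
  shortest u v = least (walk? G u v) (proj₂ conn u v)

  d : Fin n → Fin n → ℕ
  d u v = proj₁ (shortest u v)

  -- The default value of min is the distance to an element of S, so it does
  -- not affect the minimum over S.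
  dSet : Fin n → (S : Subset n) → Nonempty S → ℕ
  dSet v S (x , _) = min (d v x) (map (d v) (members S))

  rm : Fin n → Subset n → List ℕ
  rm v W = map (d v) (members W)

  MultisetResolving : Subset n → Set
  MultisetResolving W = ∀ u v → u ≢ v → ¬ (rm u W ↭ rm v W)

  rmp : ∀ {t} → Fin n → (S : Fin t → Subset n) → IsPartition S → List ℕ
  rmp v S part = tabulate (λ i → dSet v (S i) (IsPartition.nonempty part i))

  ResolvingMultisetPartition : ∀ {t} (S : Fin t → Subset n) → IsPartition S → Set
  ResolvingMultisetPartition S part =
    ∀ u v → u ≢ v → ¬ (rmp u S part ↭ rmp v S part)

  -- md(G) and mpd(G) take values in ℕ ∪ {∞}.  IsMd m and IsMpd t say that they
  -- are finite and equal to m and t; an infinite value satisfies neither.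
  IsMd : ℕ → Set
  IsMd = IsLeast (λ k → Σ (Subset n) λ W → MultisetResolving W × ∣ W ∣ ≡ k)

  IsMpd : ℕ → Set
  IsMpd = IsLeast (λ t → Σ (Fin t → Subset n) λ S →
                         Σ (IsPartition S) (ResolvingMultisetPartition S))

{-# OPTIONS --safe #-}

-- Consider m vertices whose mutual distances are at most 2, and such that every
-- other vertex is within distance 2 of all of them or equidistant from all of them.
-- In a partition into t parts, the multiset of such a vertex is determined by its
-- number of ones, which is less than t; hence mpd ≥ m.  A multiset resolving set W
-- can do better, because the distance 0 occurs only for the elements of W: if the
-- vertices have nested neighbourhoods, of sizes 1, …, m up to missing loops, it is
-- enough that W contains every second one, and 5 vertices besides.  Resolvability
-- is decidable, so md and mpd exist as soon as they are finite; with W and the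
-- partition into singletons they are, and md ≤ 5 + m / 2 while mpd ≥ m.
module Submission where

open import Defs
open import Data.Bool.Base using (Bool; true; false; if_then_else_)
open import Data.Fin.Base using (Fin; zero; suc; toℕ; fromℕ; fromℕ<; inject₁)
open import Data.Fin.Properties
  using (any?; all?; _≟_; toℕ-injective; toℕ-fromℕ; toℕ-inject₁; toℕ<n; pigeonhole; fromℕ<-injective; <⇒≢)
open import Data.Fin.Subset using (Subset; inside; outside; ⊤; ⁅_⁆; ∣_∣; _∈_; Nonempty)
open import Data.Fin.Subset.Properties
  using (_∈?_; nonempty?; anySubset?; ∣⊤∣≡n; ∈⊤; x∈⁅x⁆; x∈⁅y⁆⇒x≡y)
open import Data.List.Base using (List; []; _∷_; _++_; map; filter; allFin; tabulate)
open import Data.List.Extrema.Nat using (min≤xs; argmin-sel)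
import Data.List.Membership.Propositional as List
open import Data.List.Membership.DecPropositional using () renaming (_∈?_ to member?)
open import Data.List.Membership.Propositional.Properties
  using (∈-∃++; ∈-filter⁺; ∈-filter⁻; ∈-allFin; ∈-map⁺; ∈-map⁻)
open import Data.List.Properties using (map-tabulate; map-∘; tabulate-cong; filter-all)
open import Data.List.Relation.Binary.Permutation.Propositional
  using (_↭_; ↭-refl; ↭-sym; ↭-trans; prep)
open import Data.List.Relation.Binary.Permutation.Propositional.Properties
  using (shift; drop-mid; ∈-resp-↭; ↭-empty-inv; map⁺)
open import Data.List.Relation.Unary.All as All using ()
open import Data.List.Relation.Unary.Any using (here; there)
open import Data.Nat.Base
open import Data.Nat.ListAction using (sum)
open import Data.Nat.ListAction.Properties using (sum-↭)
open import Data.Nat.Properties hiding (_≟_; <⇒≢)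
import Data.Nat.Properties as ℕ
open import Data.Nat.Tactic.RingSolver using (solve-∀)
open import Data.Product.Base using (Σ; ∃; _×_; _,_; proj₁; proj₂)
open import Data.Sum.Base using (_⊎_; inj₁; inj₂)
open import Data.Vec.Base using ([]; _∷_; lookup)
import Data.Vec.Functional as Fun
open import Data.Vec.Properties using (lookup-replicate)
open import Function.Base using (_∘_; id; case_of_)
open import Relation.Binary.PropositionalEquality
open import Relation.Nullary using (Dec; yes; no; ¬_; does; contradiction)
open import Relation.Nullary.Decidable using (map′; _×-dec_; _→-dec_; ¬?)
import Relation.Unary as U
open import Algebra.Properties.CommutativeSemigroup +-commutativeSemigroup using (interchange)

-- Sums over subsets

ind : Bool → ℕ
ind b = if b then 1 else 0

-- Recursion along the subset, rather than a sum over `members`, lets the five leading terms of a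
-- sum over `withCore μ` unfold by computation.
∑ : ∀ {n} → Subset n → (Fin n → ℕ) → ℕ
∑ []            f = 0
∑ (inside  ∷ p) f = f zero + ∑ p (f ∘ suc)
∑ (outside ∷ p) f = ∑ p (f ∘ suc)

∑-cong : ∀ {n} (p : Subset n) {f g} → f ≗ g → ∑ p f ≡ ∑ p g
∑-cong []            f≗g = refl
∑-cong (inside  ∷ p) f≗g = cong₂ _+_ (f≗g zero) (∑-cong p (f≗g ∘ suc))
∑-cong (outside ∷ p) f≗g = ∑-cong p (f≗g ∘ suc)

∑-mono : ∀ {n} (p : Subset n) {f g} → (∀ i → f i ≤ g i) → ∑ p f ≤ ∑ p g
∑-mono []            f≤g = z≤n
∑-mono (inside  ∷ p) f≤g = +-mono-≤ (f≤g zero) (∑-mono p (f≤g ∘ suc))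
∑-mono (outside ∷ p) f≤g = ∑-mono p (f≤g ∘ suc)

∑-const : ∀ {n} (p : Subset n) c → ∑ p (λ _ → c) ≡ ∣ p ∣ * c
∑-const []            c = refl
∑-const (inside  ∷ p) c = cong (c +_) (∑-const p c)
∑-const (outside ∷ p) c = ∑-const p c

∑-zero : ∀ {n} (p : Subset n) {f} → (∀ i → f i ≡ 0) → ∑ p f ≡ 0
∑-zero p f≗0 = trans (∑-cong p f≗0) (trans (∑-const p 0) (*-zeroʳ ∣ p ∣))

∑-+ : ∀ {n} (p : Subset n) f g → ∑ p (λ i → f i + g i) ≡ ∑ p f + ∑ p g
∑-+ []            f g = refl
∑-+ (inside  ∷ p) f g = trans
  (cong (f zero + g zero +_) (∑-+ p (f ∘ suc) (g ∘ suc)))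
  (interchange (f zero) (g zero) _ _)
∑-+ (outside ∷ p) f g = ∑-+ p (f ∘ suc) (g ∘ suc)

-- Together with `∑-update-∈` this replaces `coreδ i` by `step (link i j)`, from which it differs
-- only on the diagonal. For `r` inside, the diagonal terms are added crosswise to avoid
-- subtraction.
∑-update-∉ : ∀ {n} (p : Subset n) {f g} r → (∀ i → i ≢ r → f i ≡ g i) →
             lookup p r ≡ outside → ∑ p f ≡ ∑ p g
∑-update-∉ (outside ∷ p) zero    f≗g refl = ∑-cong p (λ i → f≗g (suc i) λ ())
∑-update-∉ (inside  ∷ p) (suc r) f≗g r∉p  =
  cong₂ _+_ (f≗g zero λ ()) (∑-update-∉ p r (λ i i≢r → f≗g (suc i) (i≢r ∘ λ { refl → refl })) r∉p)
∑-update-∉ (outside ∷ p) (suc r) f≗g r∉p  =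
  ∑-update-∉ p r (λ i i≢r → f≗g (suc i) (i≢r ∘ λ { refl → refl })) r∉p

∑-update-∈ : ∀ {n} (p : Subset n) {f g} r → (∀ i → i ≢ r → f i ≡ g i) →
             lookup p r ≡ inside → ∑ p f + g r ≡ ∑ p g + f r
∑-update-∈ (inside ∷ p) {f} {g} zero f≗g refl = begin
  f zero + ∑ p (f ∘ suc) + g zero   ≡⟨ +-comm (f zero + _) (g zero) ⟩
  g zero + (f zero + ∑ p (f ∘ suc)) ≡⟨ cong (g zero +_) (+-comm (f zero) _) ⟩
  g zero + (∑ p (f ∘ suc) + f zero) ≡⟨ cong (λ s → g zero + (s + f zero)) (∑-cong p λ i → f≗g (suc i) λ ()) ⟩
  g zero + (∑ p (g ∘ suc) + f zero) ≡⟨ +-assoc (g zero) _ _ ⟨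
  g zero + ∑ p (g ∘ suc) + f zero   ∎
  where open ≡-Reasoning
∑-update-∈ (inside ∷ p) {f} {g} (suc r) f≗g r∈p = begin
  f zero + ∑ p (f ∘ suc) + g (suc r)   ≡⟨ +-assoc (f zero) _ _ ⟩
  f zero + (∑ p (f ∘ suc) + g (suc r)) ≡⟨ cong₂ _+_ (f≗g zero λ ()) (∑-update-∈ p r (λ i i≢r → f≗g (suc i) (i≢r ∘ λ { refl → refl })) r∈p) ⟩
  g zero + (∑ p (g ∘ suc) + f (suc r)) ≡⟨ +-assoc (g zero) _ _ ⟨
  g zero + ∑ p (g ∘ suc) + f (suc r)   ∎
  where open ≡-Reasoning
∑-update-∈ (outside ∷ p) (suc r) f≗g r∈p =
  ∑-update-∈ p r (λ i i≢r → f≗g (suc i) (i≢r ∘ λ { refl → refl })) r∈p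

sum-tabulate : ∀ {n} (f : Fin n → ℕ) → sum (tabulate f) ≡ ∑ ⊤ f
sum-tabulate {zero}  f = refl
sum-tabulate {suc n} f = cong (f zero +_) (sum-tabulate (f ∘ suc))

filter-∈?-suc : ∀ {n} s (p : Subset n) is →
                filter (_∈? (s ∷ p)) (map suc is) ≡ map suc (filter (_∈? p) is)
filter-∈?-suc s p []       = refl
filter-∈?-suc s p (i ∷ is) with does (i ∈? p)
... | true  = cong (suc i ∷_) (filter-∈?-suc s p is)
... | false = filter-∈?-suc s p is

filter-∈?-tabulate : ∀ {n} s (p : Subset n) →
                     filter (_∈? (s ∷ p)) (tabulate suc) ≡ map suc (members p)
filter-∈?-tabulate s p =
  trans (cong (filter (_∈? (s ∷ p))) (sym (map-tabulate id suc))) (filter-∈?-suc s p (allFin _))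

sum-members : ∀ {n} (p : Subset n) f → sum (map f (members p)) ≡ ∑ p f
sum-members []            f = refl
sum-members (inside  ∷ p) f = cong (f zero +_) (trans
  (cong (sum ∘ map f) (filter-∈?-tabulate inside p))
  (trans (cong sum (sym (map-∘ (members p)))) (sum-members p (f ∘ suc))))
sum-members (outside ∷ p) f = trans
  (cong (sum ∘ map f) (filter-∈?-tabulate outside p))
  (trans (cong sum (sym (map-∘ (members p)))) (sum-members p (f ∘ suc)))

-- Multisets of natural numbers

infix 4 _↭?_

-- One occurrence of `x` is removed from `ys`. By `drop-mid` it does not matter which one.
_↭?_ : (xs ys : List ℕ) → Dec (xs ↭ ys)
[]       ↭? []       = yes ↭-refl
[]       ↭? (y ∷ ys) = no λ p → contradiction (↭-empty-inv (↭-sym p)) λ ()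
(x ∷ xs) ↭? ys with member? ℕ._≟_ x ys
... | no x∉ys = no λ p → x∉ys (∈-resp-↭ p (here refl))
... | yes x∈ys with as , bs , refl ← ∈-∃++ x∈ys =
  map′ (λ p → ↭-trans (prep x p) (↭-sym (shift x as bs))) (drop-mid [] as) (xs ↭? as ++ bs)

occurrences : ℕ → List ℕ → ℕ
occurrences a xs = sum (map (λ x → ind (a ≡ᵇ x)) xs)

n≡ᵇn : ∀ n → (n ≡ᵇ n) ≡ true
n≡ᵇn zero    = refl
n≡ᵇn (suc n) = n≡ᵇn n

≢⇒≡ᵇ-false : ∀ {m n} → m ≢ n → (m ≡ᵇ n) ≡ false
≢⇒≡ᵇ-false {zero}  {zero}  m≢n = contradiction refl m≢n
≢⇒≡ᵇ-false {zero}  {suc n} m≢n = refl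
≢⇒≡ᵇ-false {suc m} {zero}  m≢n = refl
≢⇒≡ᵇ-false {suc m} {suc n} m≢n = ≢⇒≡ᵇ-false (m≢n ∘ cong suc)

occurs⇒∈ : ∀ a xs → occurrences a xs ≢ 0 → a List.∈ xs
occurs⇒∈ a []       o = contradiction refl o
occurs⇒∈ a (x ∷ xs) o with a ℕ.≟ x
... | yes refl = here refl
... | no a≢x rewrite ≢⇒≡ᵇ-false a≢x = there (occurs⇒∈ a xs o)

occurrences-↭ : ∀ a {xs ys} → xs ↭ ys → occurrences a xs ≡ occurrences a ys
occurrences-↭ a p = sum-↭ (map⁺ (λ x → ind (a ≡ᵇ x)) p)

-- Induction on `xs`: its head occurs in `ys` as well, and cancelling one copy on both sides keeps
-- all the counts equal.
≗-occurrences⇒↭ : ∀ xs ys → (∀ a → occurrences a xs ≡ occurrences a ys) → xs ↭ ys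
≗-occurrences⇒↭ []       []       eq = ↭-refl
≗-occurrences⇒↭ []       (y ∷ ys) eq with () ← trans (eq y) (cong (λ b → ind b + occurrences y ys) (n≡ᵇn y))
≗-occurrences⇒↭ (x ∷ xs) ys       eq
  with as , bs , refl ← ∈-∃++ (occurs⇒∈ x ys λ ≡0 →
         0≢1+n (sym (trans (cong (λ b → ind b + occurrences x xs) (sym (n≡ᵇn x))) (trans (eq x) ≡0)))) =
  ↭-trans (prep x (≗-occurrences⇒↭ xs (as ++ bs) λ a →
    +-cancelˡ-≡ (ind (a ≡ᵇ x)) _ _ (trans (eq a) (occurrences-↭ a (shift x as bs)))))
    (↭-sym (shift x as bs))

occurrences-tabulate : ∀ {n} a (f : Fin n → ℕ) →
                       occurrences a (tabulate f) ≡ ∑ ⊤ (λ i → ind (a ≡ᵇ f i))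
occurrences-tabulate a f = trans (cong sum (map-tabulate f (λ x → ind (a ≡ᵇ x)))) (sum-tabulate (λ i → ind (a ≡ᵇ f i)))

-- Where f and g differ, both take values in {0, 1, 2}, so the number of
-- twos is determined by the numbers of zeros and ones.
tabulate-↭ : ∀ {n} (f g : Fin n → ℕ) →
             (∀ i → (f i ≤ 2 × g i ≤ 2) ⊎ f i ≡ g i) →
             ∑ ⊤ (λ i → ind (0 ≡ᵇ f i)) ≡ ∑ ⊤ (λ i → ind (0 ≡ᵇ g i)) →
             ∑ ⊤ (λ i → ind (1 ≡ᵇ f i)) ≡ ∑ ⊤ (λ i → ind (1 ≡ᵇ g i)) →
             tabulate f ↭ tabulate g
tabulate-↭ {n} f g near eq₀ eq₁ = ≗-occurrences⇒↭ _ _ λ a →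
  trans (occurrences-tabulate a f) (trans (number a) (sym (occurrences-tabulate a g)))
  where
  # : ℕ → (Fin n → ℕ) → ℕ
  # a h = ∑ ⊤ (λ i → ind (a ≡ᵇ h i))

  -- The indicator of `x ≤ 2`, written as a sum so that its total splits into the counts of zeros,
  -- ones and twos.
  small : ℕ → ℕ
  small x = ind (0 ≡ᵇ x) + (ind (1 ≡ᵇ x) + ind (2 ≡ᵇ x))

  small-≤2 : ∀ {x} → x ≤ 2 → small x ≡ 1
  small-≤2 z≤n             = refl
  small-≤2 (s≤s z≤n)       = refl
  small-≤2 (s≤s (s≤s z≤n)) = refl

  small-∑ : ∀ h → ∑ ⊤ (small ∘ h) ≡ # 0 h + (# 1 h + # 2 h)
  small-∑ h = trans (∑-+ ⊤ (λ i → ind (0 ≡ᵇ h i)) _)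
    (cong (# 0 h +_) (∑-+ ⊤ (λ i → ind (1 ≡ᵇ h i)) (λ i → ind (2 ≡ᵇ h i))))

  small-eq : ∀ i → small (f i) ≡ small (g i)
  small-eq i with near i
  ... | inj₁ (f≤2 , g≤2) = trans (small-≤2 f≤2) (sym (small-≤2 g≤2))
  ... | inj₂ fi≡gi       = cong small fi≡gi

  large : ∀ a {x} → x ≤ 2 → ind (suc (suc (suc a)) ≡ᵇ x) ≡ 0
  large a z≤n             = refl
  large a (s≤s z≤n)       = refl
  large a (s≤s (s≤s z≤n)) = refl

  large-eq : ∀ a i → ind (suc (suc (suc a)) ≡ᵇ f i) ≡ ind (suc (suc (suc a)) ≡ᵇ g i)
  large-eq a i with near i
  ... | inj₁ (f≤2 , g≤2) = trans (large a f≤2) (sym (large a g≤2))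
  ... | inj₂ fi≡gi       = cong (λ x → ind (suc (suc (suc a)) ≡ᵇ x)) fi≡gi

  number : ∀ a → # a f ≡ # a g
  number 0                   = eq₀
  number 1                   = eq₁
  number 2                   = +-cancelˡ-≡ (# 1 f) _ _ (+-cancelˡ-≡ (# 0 f) _ _ (begin
    # 0 f + (# 1 f + # 2 f) ≡⟨ small-∑ f ⟨
    ∑ ⊤ (small ∘ f)         ≡⟨ ∑-cong ⊤ small-eq ⟩
    ∑ ⊤ (small ∘ g)         ≡⟨ small-∑ g ⟩
    # 0 g + (# 1 g + # 2 g) ≡⟨ cong₂ (λ a b → a + (b + # 2 g)) eq₀ eq₁ ⟨
    # 0 f + (# 1 f + # 2 g) ∎))
    where open ≡-Reasoning
  number (suc (suc (suc a))) = ∑-cong ⊤ (large-eq a)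

-- Deciding the two kinds of resolvability

-- A family is a function, and one rebuilt from its head and tail agrees with the original only
-- pointwise. Hence `P` is required to respect `≗`.
anyFamily? : ∀ {n} t {P : (Fin t → Subset n) → Set} →
             (∀ {S T} → S ≗ T → P S → P T) → U.Decidable P → Dec (∃ P)
anyFamily? zero    resp P? = map′ (_ ,_) (λ (S , p) → resp (λ ()) p) (P? (λ ()))
anyFamily? (suc t) {P} resp P? = map′
  (λ (s , S , p) → s Fun.∷ S , p)
  (λ (S , p) → S zero , S ∘ suc , resp (λ { zero → refl ; (suc _) → refl }) p)
  (anySubset? λ s → anyFamily? t
    (λ S≗T → resp λ { zero → refl ; (suc i) → S≗T i }) (λ S → P? (s Fun.∷ S)))

module _ {n t : ℕ} where

  partition? : (S : Fin t → Subset n) → Dec (IsPartition S)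
  partition? S = map′
    (λ (ne , un) → record { nonempty = ne
                          ; unique = λ v → case un v of λ (i , v∈ , !) → i , v∈ , λ {j} → ! j })
    (λ part → let open IsPartition part in
              nonempty , λ v → case unique v of λ (i , v∈ , !) → i , v∈ , λ j → ! {j})
    (all? (λ i → nonempty? (S i)) ×-dec
     all? (λ v → any? λ i → (v ∈? S i) ×-dec all? λ j → (v ∈? S j) →-dec (i ≟ j)))

  partition-resp : {S T : Fin t → Subset n} → S ≗ T → IsPartition S → IsPartition T
  partition-resp {S} {T} S≗T part = record
    { nonempty = λ i → subst Nonempty (S≗T i) (nonempty i)
    ; unique   = λ v → case unique v of λ (i , v∈ , !) →
        i , subst (v ∈_) (S≗T i) v∈ , λ {j} v∈T → ! (subst (v ∈_) (sym (S≗T j)) v∈T)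
    }
    where open IsPartition part

-- Distances from a vertex to a set

∈-members⁺ : ∀ {n} {S : Subset n} {x} → x ∈ S → x List.∈ members S
∈-members⁺ {S = S} {x} x∈S = ∈-filter⁺ (_∈? S) (∈-allFin x) x∈S

∈-members⁻ : ∀ {n} {S : Subset n} {x} → x List.∈ members S → x ∈ S
∈-members⁻ {n} {S} x∈ = proj₂ (∈-filter⁻ (_∈? S) {xs = allFin n} x∈)

module _ {n : ℕ} (G : Graph n) (conn : Connected G) where

  private
    dist : Fin n → Fin n → ℕ
    dist = d G conn

    distSet : Fin n → (S : Subset n) → Nonempty S → ℕ
    distSet = dSet G conn

  d-walk : ∀ u v → Walk G u v (dist u v)
  d-walk u v = proj₁ (proj₂ (shortest G conn u v))

  d-least : ∀ {u v k} → Walk G u v k → dist u v ≤ k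
  d-least {u} {v} = proj₂ (proj₂ (shortest G conn u v)) _

  d≡0⇒≡ : ∀ {u v} → dist u v ≡ 0 → u ≡ v
  d≡0⇒≡ {u} {v} eq with [] ← subst (Walk G u v) eq (d-walk u v) = refl

  dSet-≤ : ∀ v (S : Subset n) ne {y} → y ∈ S → distSet v S ne ≤ dist v y
  dSet-≤ v S (x , _) y∈S =
    All.lookup (min≤xs (dist v x) (map (dist v) (members S))) (∈-map⁺ (dist v) (∈-members⁺ y∈S))

  dSet-attained : ∀ v (S : Subset n) ne → ∃ λ y → y ∈ S × distSet v S ne ≡ dist v y
  dSet-attained v S (x , x∈S) with argmin-sel id (dist v x) (map (dist v) (members S))
  ... | inj₁ eq = x , x∈S , eq
  ... | inj₂ m∈ with y , y∈ , eq ← ∈-map⁻ (dist v) m∈ = y , ∈-members⁻ y∈ , eq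

  -- The default value in `dSet` comes from the witness `ne`, and two proofs of `IsPartition` may
  -- carry different witnesses. Either way the value is attained in `S` and is a lower bound there.
  dSet-irrelevant : ∀ v (S : Subset n) ne ne′ → distSet v S ne ≡ distSet v S ne′
  dSet-irrelevant v S ne ne′ = ≤-antisym (half ne ne′) (half ne′ ne)
    where
    half : ∀ ne ne′ → distSet v S ne ≤ distSet v S ne′
    half ne ne′ with y , y∈S , eq ← dSet-attained v S ne′ rewrite eq = dSet-≤ v S ne y∈S

  dSet-cong : ∀ v {S T : Subset n} → S ≡ T → ∀ ne ne′ → distSet v S ne ≡ distSet v T ne′
  dSet-cong v refl = dSet-irrelevant v _

  rmp-cong : ∀ {t} v {S T : Fin t → Subset n} → S ≗ T → ∀ part part′ →
             rmp G conn v S part ≡ rmp G conn v T part′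
  rmp-cong v S≗T part part′ = tabulate-cong λ i →
    dSet-cong v (S≗T i) (IsPartition.nonempty part i) (IsPartition.nonempty part′ i)

  resolving? : ∀ {A : Fin n → List ℕ} → Dec (∀ u v → u ≢ v → ¬ (A u ↭ A v))
  resolving? {A} = all? λ u → all? λ v → ¬? (u ≟ v) →-dec ¬? (A u ↭? A v)

  multisetResolving? : ∀ k → Dec (Σ (Subset n) λ W → MultisetResolving G conn W × ∣ W ∣ ≡ k)
  multisetResolving? k = anySubset? λ W → resolving? ×-dec (∣ W ∣ ℕ.≟ k)

  ResolvingFamily : ∀ {t} → (Fin t → Subset n) → Set
  ResolvingFamily S = Σ (IsPartition S) (ResolvingMultisetPartition G conn S)

  resolvingFamily-resp : ∀ {t} {S T : Fin t → Subset n} → S ≗ T →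
                         ResolvingFamily S → ResolvingFamily T
  resolvingFamily-resp S≗T (part , res) = part′ , λ u v u≢v p →
    res u v u≢v (subst₂ _↭_ (sym (rmp-cong u S≗T part part′)) (sym (rmp-cong v S≗T part part′)) p)
    where part′ = partition-resp S≗T part

  resolvingFamily? : ∀ {t} (S : Fin t → Subset n) → Dec (ResolvingFamily S)
  resolvingFamily? S with partition? S
  ... | no ¬part = no λ (part , _) → ¬part part
  ... | yes part = map′ (part ,_)
    (λ (part′ , res) u v u≢v p → res u v u≢v (subst₂ _↭_ (rmp-cong u (λ _ → refl) part part′)
                                                           (rmp-cong v (λ _ → refl) part part′) p))
    resolving?

  resolvingPartition? : ∀ t → Dec (∃ (ResolvingFamily {t}))
  resolvingPartition? t = anyFamily? t resolvingFamily-resp resolvingFamily?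

  -- The partition into singletons

  singletons : IsPartition {n} ⁅_⁆
  singletons = record
    { nonempty = λ i → i , x∈⁅x⁆ i
    ; unique   = λ v → v , x∈⁅x⁆ v , λ {i} v∈ → x∈⁅y⁆⇒x≡y i v∈
    }

  members-⊤ : members {n} ⊤ ≡ allFin n
  members-⊤ = filter-all (_∈? ⊤) (All.universal (λ _ → ∈⊤) (allFin n))

  rmp-singletons : ∀ v → rmp G conn v ⁅_⁆ singletons ≡ rm G conn v ⊤
  rmp-singletons v = trans (tabulate-cong single)
    (trans (sym (map-tabulate id (dist v))) (cong (map (dist v)) (sym members-⊤)))
    where
    single : ∀ i → distSet v ⁅ i ⁆ (i , x∈⁅x⁆ i) ≡ dist v i
    single i with y , y∈ , eq ← dSet-attained v ⁅ i ⁆ (i , x∈⁅x⁆ i)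
      rewrite eq | x∈⁅y⁆⇒x≡y i y∈ = refl

  -- This makes mpd finite: for singletons the multiset of a vertex is that of its distances to all
  -- vertices.
  singletons-resolving : MultisetResolving G conn ⊤ → ResolvingFamily ⁅_⁆
  singletons-resolving res = singletons , λ u v u≢v p →
    res u v u≢v (subst₂ _↭_ (rmp-singletons u) (rmp-singletons v) p)

  -- Each `g` gives a numerical invariant of the multiset. Indicators of thresholds as `g` count the
  -- distances on one side of a bound, and these counts tell the vertices apart.
  rm-invariant : ∀ {u v W} → rm G conn u W ↭ rm G conn v W →
                 ∀ g → ∑ W (λ w → g (dist u w)) ≡ ∑ W (λ w → g (dist v w))
  rm-invariant {u} {v} {W} p g = trans (sym (weight u)) (trans (sum-↭ (map⁺ g p)) (weight v))
    where
    weight : ∀ u → sum (map g (rm G conn u W)) ≡ ∑ W (λ w → g (dist u w))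
    weight u = trans (cong sum (sym (map-∘ (members W)))) (sum-members W _)

-- Threshold indicators

ind-<ᵇ-mono : ∀ m {a b} → a ≤ b → ind (m <ᵇ a) ≤ ind (m <ᵇ b)
ind-<ᵇ-mono m       z≤n       = z≤n
ind-<ᵇ-mono zero    (s≤s a≤b) = ≤-refl
ind-<ᵇ-mono (suc m) (s≤s a≤b) = ind-<ᵇ-mono m a≤b

+-≤-≡⇒≡ : ∀ {a a′ b b′} → a ≤ a′ → b ≤ b′ → a + b ≡ a′ + b′ → b ≡ b′
+-≤-≡⇒≡ {a} {a′} {b} {b′} a≤a′ b≤b′ eq = ≤-antisym b≤b′ (+-cancelˡ-≤ a b′ b (begin
  a + b′  ≤⟨ +-monoˡ-≤ b′ a≤a′ ⟩
  a′ + b′ ≡⟨ eq ⟨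
  a + b   ∎))
  where open ≤-Reasoning

atLeast atMost : ℕ → ℕ → ℕ
atLeast b x = ind (b ≤ᵇ x)
atMost  b x = ind (x ≤ᵇ b)

atLeast3-≤2 : ∀ b {x} → x ≤ 2 → atLeast (3 + b) x ≡ 0
atLeast3-≤2 b z≤n             = refl
atLeast3-≤2 b (s≤s z≤n)       = refl
atLeast3-≤2 b (s≤s (s≤s z≤n)) = refl

-- `k ⊓ s` counts the numbers below `k` that are less than `s`, and the indicator extends the range
-- by `k` itself.
ind-⊓ : ∀ k s → ind (k <ᵇ s) + k ⊓ s ≡ suc k ⊓ s
ind-⊓ k       zero    = ⊓-zeroʳ k
ind-⊓ zero    (suc s) = refl
ind-⊓ (suc k) (suc s) = trans (+-suc _ (k ⊓ s)) (cong suc (ind-⊓ k s))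

-- The condition holds exactly for the last `r` indices, or for all `m` if `r` is larger. Index 0 is
-- split off, and for the others both sides of the inequality drop by one.
∑-threshold-⊤ : ∀ m r → ∑ (⊤ {m}) (λ j → ind (m <ᵇ r + suc (toℕ j))) ≡ m ⊓ r
∑-threshold-⊤ zero    r = refl
∑-threshold-⊤ (suc m) r = begin
  ind (suc m <ᵇ r + 1) + ∑ (⊤ {m}) (λ j → ind (suc m <ᵇ r + suc (suc (toℕ j))))
    ≡⟨ cong₂ (λ n s → ind (suc m <ᵇ n) + s) (+-comm r 1)
         (trans (∑-cong (⊤ {m}) (λ j → cong (λ n → ind (suc m <ᵇ n)) (+-suc r (suc (toℕ j))))) (∑-threshold-⊤ m r)) ⟩
  ind (m <ᵇ r) + m ⊓ r
    ≡⟨ ind-⊓ m r ⟩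
  suc m ⊓ r ∎
  where open ≡-Reasoning

alternate : ∀ k → Subset (k * 2)
alternate zero    = []
alternate (suc k) = inside ∷ outside ∷ alternate k

∣alternate∣ : ∀ k → ∣ alternate k ∣ ≡ k
∣alternate∣ zero    = refl
∣alternate∣ (suc k) = cong suc (∣alternate∣ k)

<ᵇ-half : ∀ k r → (suc (k * 2) <ᵇ r) ≡ (k <ᵇ ⌊ r /2⌋)
<ᵇ-half k       zero          = refl
<ᵇ-half zero    (suc zero)    = refl
<ᵇ-half (suc k) (suc zero)    = refl
<ᵇ-half zero    (suc (suc r)) = refl
<ᵇ-half (suc k) (suc (suc r)) = <ᵇ-half k r

-- Again the last `r` indices are selected. The very last index is outside, so for `r` up to `k * 2`
-- every second of them counts and the half is rounded down.
∑-threshold-alternate : ∀ k r → ∑ (alternate k) (λ j → ind (k * 2 <ᵇ r + suc (toℕ j))) ≡ k ⊓ ⌊ r /2⌋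
∑-threshold-alternate zero    r = refl
∑-threshold-alternate (suc k) r = begin
  ind (2 + k * 2 <ᵇ r + 1) + ∑ (alternate k) (λ j → ind (2 + k * 2 <ᵇ r + suc (2 + toℕ j)))
    ≡⟨ cong₂ (λ n s → ind (2 + k * 2 <ᵇ n) + s) (+-comm r 1)
         (trans (∑-cong (alternate k) (λ j → cong (λ n → ind (2 + k * 2 <ᵇ n)) (shift₂ (toℕ j)))) (∑-threshold-alternate k r)) ⟩
  ind (suc (k * 2) <ᵇ r) + k ⊓ ⌊ r /2⌋
    ≡⟨ cong (λ b → ind b + k ⊓ ⌊ r /2⌋) (<ᵇ-half k r) ⟩
  ind (k <ᵇ ⌊ r /2⌋) + k ⊓ ⌊ r /2⌋
    ≡⟨ ind-⊓ k ⌊ r /2⌋ ⟩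
  suc k ⊓ ⌊ r /2⌋ ∎
  where
  open ≡-Reasoning
  shift₂ : ∀ j → r + suc (2 + j) ≡ 2 + (r + suc j)
  shift₂ j = trans (+-suc r (2 + j)) (cong suc (+-suc r (suc j)))

half-≤ : ∀ k (i : Fin (k * 2)) → ⌊ suc (toℕ i) /2⌋ ≤ k
half-≤ (suc k) zero          = z≤n
half-≤ (suc k) (suc zero)    = s≤s z≤n
half-≤ (suc k) (suc (suc i)) = s≤s (half-≤ k i)

-- Only the ranks `2l` and `2l + 1` share a half, and they have opposite membership in
-- `alternate k`.
alternate-half-injective : ∀ k (i j : Fin (k * 2)) → lookup (alternate k) i ≡ lookup (alternate k) j →
                           ⌊ suc (toℕ i) /2⌋ ≡ ⌊ suc (toℕ j) /2⌋ → i ≡ j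
alternate-half-injective (suc k) zero          zero          _ _ = refl
alternate-half-injective (suc k) (suc zero)    (suc zero)    _ _ = refl
-- Pairs with a common half straddle the blocks of two on which the induction runs, so index 1 is
-- compared with the later indices separately.
alternate-half-injective (suc (suc k)) (suc zero) (suc (suc zero))    () _
alternate-half-injective (suc (suc k)) (suc zero) (suc (suc (suc j))) _ ()
alternate-half-injective (suc (suc k)) (suc (suc zero))    (suc zero) () _
alternate-half-injective (suc (suc k)) (suc (suc (suc i))) (suc zero) _ ()
alternate-half-injective (suc k) (suc (suc i)) (suc (suc j)) e h =
  cong (λ l → suc (suc l)) (alternate-half-injective k i j e (suc-injective h))

-- The graphs

<ᵇ-+suc : ∀ n k → (n <ᵇ n + suc k) ≡ true
<ᵇ-+suc zero    k = refl
<ᵇ-+suc (suc n) k = <ᵇ-+suc n k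

∣suc-inject₁∣ : ∀ {n} (i : Fin n) → ∣ suc (toℕ i) - toℕ (inject₁ i) ∣ ≡ 1
∣suc-inject₁∣ zero    = refl
∣suc-inject₁∣ (suc i) = ∣suc-inject₁∣ i

path-geodesic : ∀ {n} (i j : Fin n) {k} → ∣ toℕ i - toℕ j ∣ ≡ suc k →
                ∃ λ (l : Fin n) → ∣ toℕ i - toℕ l ∣ ≡ 1 × ∣ toℕ l - toℕ j ∣ ≡ k
path-geodesic zero    (suc zero)    refl = suc zero , refl , refl
path-geodesic zero    (suc (suc j)) refl = suc zero , refl , refl
path-geodesic (suc i) zero          refl = inject₁ i , ∣suc-inject₁∣ i , trans (∣-∣-comm (toℕ (inject₁ i)) 0) (toℕ-inject₁ i)
path-geodesic (suc i) (suc j)       eq   with l , e₁ , e₂ ← path-geodesic i j eq = suc l , e₁ , e₂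

-- The core vertex i has rank i + 1.  Core vertices are linked when their ranks
-- sum to more than m, so neighbourhoods are nested and, were loops allowed, the
-- degree would be the rank.  Adjacency to the hub replaces exactly the missing
-- loops.  The tail is a path whose end 0 is adjacent to the whole core but not to
-- the hub; it distinguishes the hub from the core.  A shorter tail would not do:
-- the vertex next to its end 0 would look like a core vertex of rank 1.
module Nested (m′ : ℕ) where

  m : ℕ
  m = suc m′

  data Vertex : Set where
    hub  : Vertex
    tail : Fin 4 → Vertex
    core : Fin m → Vertex

  -- Prescribed distances

  link : Fin m → Fin m → Bool
  link i j = m <ᵇ suc (toℕ i) + suc (toℕ j)

  step : Bool → ℕ
  step b = if b then 1 else 2

  coreδ : Fin m → Fin m → ℕ
  coreδ i j = if does (i ≟ j) then 0 else step (link i j)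

  -- The metric is prescribed first; adjacency is then defined as `δ` being 1, and `d≡δ` confirms
  -- that shortest paths have these lengths.
  δ : Vertex → Vertex → ℕ
  δ hub      hub      = 0
  δ hub      (tail j) = 2 + toℕ j
  δ hub      (core j) = step (link j j)
  δ (tail i) hub      = 2 + toℕ i
  δ (tail i) (tail j) = ∣ toℕ i - toℕ j ∣
  δ (tail i) (core j) = 1 + toℕ i
  δ (core i) hub      = step (link i i)
  δ (core i) (tail j) = 1 + toℕ j
  δ (core i) (core j) = coreδ i j

  coreδ-refl : ∀ i → coreδ i i ≡ 0
  coreδ-refl i with i ≟ i
  ... | yes _  = refl
  ... | no i≢i = contradiction refl i≢i

  coreδ-≢ : ∀ {i j} → i ≢ j → coreδ i j ≡ step (link i j)
  coreδ-≢ {i} {j} i≢j with i ≟ j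
  ... | yes i≡j = contradiction i≡j i≢j
  ... | no _    = refl

  link-sym : ∀ i j → link i j ≡ link j i
  link-sym i j = cong (m <ᵇ_) (+-comm (suc (toℕ i)) (suc (toℕ j)))

  coreδ-sym : ∀ i j → coreδ i j ≡ coreδ j i
  coreδ-sym i j with i ≟ j
  ... | yes refl = sym (coreδ-refl i)
  ... | no i≢j   = trans (cong step (link-sym i j)) (sym (coreδ-≢ (i≢j ∘ sym)))

  step-≤2 : ∀ b → step b ≤ 2
  step-≤2 true  = s≤s z≤n
  step-≤2 false = ≤-refl

  step-≥1 : ∀ b → 1 ≤ step b
  step-≥1 true  = s≤s z≤n
  step-≥1 false = s≤s z≤n

  coreδ-≤2 : ∀ i j → coreδ i j ≤ 2
  coreδ-≤2 i j with i ≟ j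
  ... | yes _ = z≤n
  ... | no _  = step-≤2 (link i j)

  δ-refl : ∀ u → δ u u ≡ 0
  δ-refl hub      = refl
  δ-refl (tail i) = ∣n-n∣≡0 (toℕ i)
  δ-refl (core i) = coreδ-refl i

  δ-sym : ∀ u v → δ u v ≡ δ v u
  δ-sym hub      hub      = refl
  δ-sym hub      (tail j) = refl
  δ-sym hub      (core j) = refl
  δ-sym (tail i) hub      = refl
  δ-sym (tail i) (tail j) = ∣-∣-comm (toℕ i) (toℕ j)
  δ-sym (tail i) (core j) = refl
  δ-sym (core i) hub      = refl
  δ-sym (core i) (tail j) = refl
  δ-sym (core i) (core j) = coreδ-sym i j

  step≢0 : ∀ b → step b ≢ 0
  step≢0 true  ()
  step≢0 false ()

  δ≡0⇒≡ : ∀ u v → δ u v ≡ 0 → u ≡ v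
  δ≡0⇒≡ hub      hub      eq = refl
  δ≡0⇒≡ hub      (core j) eq = contradiction eq (step≢0 (link j j))
  δ≡0⇒≡ (tail i) (tail j) eq = cong tail (toℕ-injective (∣m-n∣≡0⇒m≡n eq))
  δ≡0⇒≡ (core i) hub      eq = contradiction eq (step≢0 (link i i))
  δ≡0⇒≡ (core i) (core j) eq with i ≟ j
  ... | yes refl = refl
  ... | no _     = contradiction eq (step≢0 (link i j))

  -- A level function that changes by at most 1 along an edge, which bounds the lengths of walks
  -- from below.
  pos : Vertex → ℕ
  pos hub      = 0
  pos (core _) = 1
  pos (tail i) = 2 + toℕ i

  pos-≤δ : ∀ u v → ∣ pos u - pos v ∣ ≤ δ u v
  pos-≤δ hub      hub      = z≤n
  pos-≤δ hub      (tail j) = ≤-refl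
  pos-≤δ hub      (core j) = step-≥1 (link j j)
  pos-≤δ (tail i) hub      = ≤-refl
  pos-≤δ (tail i) (tail j) = ≤-refl
  pos-≤δ (tail i) (core j) = ≤-refl
  pos-≤δ (core i) hub      = step-≥1 (link i i)
  pos-≤δ (core i) (tail j) = ≤-refl
  pos-≤δ (core i) (core j) = z≤n

  δ-pos : ∀ u v → δ u v ≤ 2 ⊎ δ u v ≡ ∣ pos u - pos v ∣
  δ-pos hub      hub      = inj₁ z≤n
  δ-pos hub      (tail j) = inj₂ refl
  δ-pos hub      (core j) = inj₁ (step-≤2 (link j j))
  δ-pos (tail i) hub      = inj₂ refl
  δ-pos (tail i) (tail j) = inj₂ refl
  δ-pos (tail i) (core j) = inj₂ refl
  δ-pos (core i) hub      = inj₁ (step-≤2 (link i i))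
  δ-pos (core i) (tail j) = inj₂ refl
  δ-pos (core i) (core j) = inj₁ (coreδ-≤2 i j)

  top : Fin m
  top = fromℕ m′

  link-top : ∀ j → link top j ≡ true
  link-top j = subst (λ n → (m <ᵇ suc n + suc (toℕ j)) ≡ true) (sym (toℕ-fromℕ m′)) (<ᵇ-+suc m (toℕ j))

  coreδ-top : ∀ j → link j j ≡ false → coreδ j top ≡ 1
  coreδ-top j eq = trans
    (coreδ-≢ {j} {top} λ { refl → case trans (sym (link-top top)) eq of λ () })
    (cong step (trans (link-sym j top) (link-top j)))

  δ-hub-top : step (link top top) ≡ 1
  δ-hub-top = cong step (link-top top)

  -- A neighbour of `u` lies one step closer to `w`; iterated, this yields a walk of length `δ u w`.
  δ-geodesic : ∀ u w {k} → δ u w ≡ suc k → ∃ λ v → δ u v ≡ 1 × δ v w ≡ k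
  δ-geodesic hub (tail j) refl = core top , δ-hub-top , refl
  δ-geodesic hub (core j) eq with link j j in l
  δ-geodesic hub (core j) refl | true  = core j , cong step l , coreδ-refl j
  -- The core vertex of highest rank is adjacent to the hub and to all other core vertices.
  δ-geodesic hub (core j) refl | false = core top , δ-hub-top , trans (coreδ-sym top j) (coreδ-top j l)
  δ-geodesic (tail zero)    hub      refl = core top , refl , δ-hub-top
  δ-geodesic (tail (suc i)) hub      refl = tail (inject₁ i) , ∣suc-inject₁∣ i , cong (2 +_) (toℕ-inject₁ i)
  δ-geodesic (tail i)       (tail j) eq   with l , e₁ , e₂ ← path-geodesic i j eq = tail l , e₁ , e₂
  δ-geodesic (tail zero)    (core j) refl = core j , refl , coreδ-refl j
  δ-geodesic (tail (suc i)) (core j) refl = tail (inject₁ i) , ∣suc-inject₁∣ i , cong suc (toℕ-inject₁ i)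
  δ-geodesic (core i) hub eq with link i i in l
  δ-geodesic (core i) hub refl | true  = hub , cong step l , refl
  δ-geodesic (core i) hub refl | false = core top , coreδ-top i l , δ-hub-top
  δ-geodesic (core i) (tail j) refl = tail zero , refl , refl
  δ-geodesic (core i) (core j) eq with i ≟ j
  ... | no i≢j with link i j in l
  δ-geodesic (core i) (core j) refl | no i≢j | true  = core j , trans (coreδ-≢ i≢j) (cong step l) , coreδ-refl j
  -- Core vertices that are not linked meet at the end of the tail.
  δ-geodesic (core i) (core j) refl | no i≢j | false = tail zero , refl , refl

  -- The graph and its distance

  vertex : Fin (5 + m) → Vertex
  vertex zero                            = hub
  vertex (suc zero)                      = tail zero
  vertex (suc (suc zero))                = tail (suc zero)
  vertex (suc (suc (suc zero)))          = tail (suc (suc zero))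
  vertex (suc (suc (suc (suc zero))))    = tail (suc (suc (suc zero)))
  vertex (suc (suc (suc (suc (suc j))))) = core j

  index : Vertex → Fin (5 + m)
  index hub                            = zero
  index (tail zero)                    = suc zero
  index (tail (suc zero))              = suc (suc zero)
  index (tail (suc (suc zero)))        = suc (suc (suc zero))
  index (tail (suc (suc (suc zero))))  = suc (suc (suc (suc zero)))
  index (core j)                       = suc (suc (suc (suc (suc j))))

  vertex-index : ∀ v → vertex (index v) ≡ v
  vertex-index hub                            = refl
  vertex-index (tail zero)                    = refl
  vertex-index (tail (suc zero))              = refl
  vertex-index (tail (suc (suc zero)))        = refl
  vertex-index (tail (suc (suc (suc zero))))  = refl
  vertex-index (core j)                       = refl

  index-vertex : ∀ i → index (vertex i) ≡ i
  index-vertex zero                            = refl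
  index-vertex (suc zero)                      = refl
  index-vertex (suc (suc zero))                = refl
  index-vertex (suc (suc (suc zero)))          = refl
  index-vertex (suc (suc (suc (suc zero))))    = refl
  index-vertex (suc (suc (suc (suc (suc j))))) = refl

  vertex-injective : ∀ {i j} → vertex i ≡ vertex j → i ≡ j
  vertex-injective {i} {j} eq = trans (sym (index-vertex i)) (trans (cong index eq) (index-vertex j))

  δ′ : Fin (5 + m) → Fin (5 + m) → ℕ
  δ′ u v = δ (vertex u) (vertex v)

  G : Graph (5 + m)
  G = record
    { Adj    = λ u v → δ′ u v ≡ 1
    ; adj?   = λ u v → δ′ u v ℕ.≟ 1
    ; sym    = λ {u} {v} a → trans (δ-sym (vertex v) (vertex u)) a
    ; irrefl = λ { {u} refl a → case trans (sym (δ-refl (vertex u))) a of λ () }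
    }

  geodesic : ∀ k u v → δ′ u v ≡ k → Walk G u v k
  geodesic zero    u v eq = subst (λ w → Walk G u w 0) (vertex-injective (δ≡0⇒≡ (vertex u) (vertex v) eq)) []
  geodesic (suc k) u v eq with w , e₁ , e₂ ← δ-geodesic (vertex u) (vertex v) eq =
    trans (cong (δ (vertex u)) (vertex-index w)) e₁ ∷
    geodesic k (index w) v (trans (cong (λ x → δ x (vertex v)) (vertex-index w)) e₂)

  connected : Connected G
  connected = zero , λ u v → δ′ u v , geodesic _ u v refl

  pos-walk : ∀ {u v k} → Walk G u v k → ∣ pos (vertex u) - pos (vertex v) ∣ ≤ k
  pos-walk {u} []  = ≤-reflexive (∣n-n∣≡0 (pos (vertex u)))
  pos-walk {u} {v} (_∷_ {v = w} a p) = ≤-trans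
    (∣-∣-triangle (pos (vertex u)) (pos (vertex w)) (pos (vertex v)))
    (+-mono-≤ (subst (∣ pos (vertex u) - pos (vertex w) ∣ ≤_) a (pos-≤δ (vertex u) (vertex w))) (pos-walk p))

  -- Walks with at most one edge are immediate. For longer ones a distance up to 2 needs no
  -- argument, and the others are differences of levels.
  δ-walk : ∀ {u v k} → Walk G u v k → δ′ u v ≤ k
  δ-walk {u} [] = ≤-reflexive (δ-refl (vertex u))
  δ-walk (a ∷ []) = ≤-reflexive a
  δ-walk {u} {v} p@(_ ∷ _ ∷ _) with δ-pos (vertex u) (vertex v)
  ... | inj₁ δ≤2 = ≤-trans δ≤2 (s≤s (s≤s z≤n))
  ... | inj₂ eq  = ≤-trans (≤-reflexive eq) (pos-walk p)

  d≡δ : ∀ u v → d G connected u v ≡ δ′ u v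
  d≡δ u v = ≤-antisym (d-least G connected (geodesic _ u v refl)) (δ-walk (d-walk G connected u v))

  -- Multiset resolving sets containing the hub and the tail

  withCore : Subset m → Subset (5 + m)
  withCore μ = inside ∷ inside ∷ inside ∷ inside ∷ inside ∷ μ

  -- Loops are counted here, so that for `μ = ⊤` this is the rank.
  linked : Subset m → Fin m → ℕ
  linked μ i = ∑ μ (λ j → ind (link i j))

  loop-mono : ∀ {i j : Fin m} → toℕ i ≤ toℕ j → ind (link i i) ≤ ind (link j j)
  loop-mono i≤j = ind-<ᵇ-mono m (+-mono-≤ (s≤s i≤j) (s≤s i≤j))

  step-≰0 : ∀ b → atMost 0 (step b) ≡ 0
  step-≰0 true  = refl
  step-≰0 false = refl

  step-≤1 : ∀ b → atMost 1 (step b) ≡ ind b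
  step-≤1 true  = refl
  step-≤1 false = refl

  coreδ-≰0 : ∀ i j → j ≢ i → atMost 0 (coreδ i j) ≡ 0
  coreδ-≰0 i j j≢i = trans (cong (atMost 0) (coreδ-≢ (j≢i ∘ sym))) (step-≰0 (link i j))

  coreδ-≤1 : ∀ i j → j ≢ i → atMost 1 (coreδ i j) ≡ ind (link i j)
  coreδ-≤1 i j j≢i = trans (cong (atMost 1) (coreδ-≢ (j≢i ∘ sym))) (step-≤1 (link i j))

  -- Both `⊤` and `alternate k` are used as `μ`. Having at least two elements in `μ` keeps
  -- `1 + ∣ μ ∣` above 2, which separates the last tail vertex from the hub and the third from the
  -- core.
  module _ (μ : Subset m) (q : ℕ) (size : ∣ μ ∣ ≡ 2 + q)
           (separates : ∀ i j → lookup μ i ≡ lookup μ j → linked μ i ≡ linked μ j → i ≡ j) where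

    weight : (ℕ → ℕ) → Vertex → ℕ
    weight g u = ∑ (withCore μ) (λ w → g (δ u (vertex w)))

    core-size : ∑ μ (λ _ → 1) ≡ 2 + q
    core-size = trans (∑-const μ 1) (trans (*-identityʳ ∣ μ ∣) size)

    core-empty : ∑ μ (λ _ → 0) ≡ 0
    core-empty = ∑-zero μ (λ _ → refl)

    atLeast-hub : ∀ b i → atLeast (3 + b) (step (link i i)) ≡ 0
    atLeast-hub b i = atLeast3-≤2 b (step-≤2 (link i i))

    atLeast-core : ∀ b i → ∑ μ (λ j → atLeast (3 + b) (coreδ i j)) ≡ 0
    atLeast-core b i = ∑-zero μ (λ j → atLeast3-≤2 b (coreδ-≤2 i j))

    -- Counting distances of at least 4 leaves two groups to be split: the first two tail vertices,
    -- and the third tail vertex with the core.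
    number≥4 : Vertex → ℕ
    number≥4 hub                           = 2
    number≥4 (tail zero)                   = 0
    number≥4 (tail (suc zero))             = 0
    number≥4 (tail (suc (suc zero)))       = 1
    number≥4 (tail (suc (suc (suc zero)))) = 3 + q
    number≥4 (core i)                      = 1

    weight-≥4 : ∀ u → weight (atLeast 4) u ≡ number≥4 u
    weight-≥4 hub                           = cong (2 +_) (∑-zero μ (atLeast-hub 1))
    weight-≥4 (tail zero)                   = core-empty
    weight-≥4 (tail (suc zero))             = core-empty
    weight-≥4 (tail (suc (suc zero)))       = cong suc core-empty
    weight-≥4 (tail (suc (suc (suc zero)))) = cong suc core-size
    weight-≥4 (core i)                      = cong₂ (λ a b → a + suc b) (atLeast-hub 1 i) (atLeast-core 1 i)

    weight-≥3-core : ∀ i → weight (atLeast 3) (core i) ≡ 2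
    weight-≥3-core i = cong₂ (λ a b → a + (2 + b)) (atLeast-hub 0 i) (atLeast-core 0 i)

    -- The number of zeros reveals whether a core vertex belongs to `μ`.
    weight-≤0-core-∈ : ∀ i → lookup μ i ≡ inside → weight (atMost 0) (core i) ≡ 1
    weight-≤0-core-∈ i i∈μ = cong₂ _+_ (step-≰0 (link i i)) (begin
      ∑ μ (λ j → atMost 0 (coreδ i j))     ≡⟨ +-identityʳ _ ⟨
      ∑ μ (λ j → atMost 0 (coreδ i j)) + 0 ≡⟨ ∑-update-∈ μ i (coreδ-≰0 i) i∈μ ⟩
      ∑ μ (λ _ → 0) + atMost 0 (coreδ i i) ≡⟨ cong₂ (λ a b → a + atMost 0 b) core-empty (coreδ-refl i) ⟩
      1                                    ∎)
      where open ≡-Reasoning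

    weight-≤0-core-∉ : ∀ i → lookup μ i ≡ outside → weight (atMost 0) (core i) ≡ 0
    weight-≤0-core-∉ i i∉μ = cong₂ _+_ (step-≰0 (link i i))
      (trans (∑-update-∉ μ i (coreδ-≰0 i) i∉μ) core-empty)

    -- The hub supplies the loop that `coreδ` lacks. The remaining 2 counts the vertex itself, at
    -- distance 0, and the end of the tail, at distance 1.
    weight-≤1-core-∈ : ∀ i → lookup μ i ≡ inside → weight (atMost 1) (core i) ≡ 2 + linked μ i
    weight-≤1-core-∈ i i∈μ = begin
      atMost 1 (step (link i i)) + suc near   ≡⟨ +-suc _ near ⟩
      suc (atMost 1 (step (link i i)) + near) ≡⟨ cong (λ a → suc (a + near)) (step-≤1 (link i i)) ⟩
      suc (ind (link i i) + near)             ≡⟨ cong suc (+-comm (ind (link i i)) near) ⟩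
      suc (near + ind (link i i))             ≡⟨ cong suc (∑-update-∈ μ i (coreδ-≤1 i) i∈μ) ⟩
      suc (linked μ i + atMost 1 (coreδ i i)) ≡⟨ cong (λ x → suc (linked μ i + atMost 1 x)) (coreδ-refl i) ⟩
      suc (linked μ i + 1)                    ≡⟨ cong suc (+-comm (linked μ i) 1) ⟩
      2 + linked μ i                          ∎
      where
      open ≡-Reasoning
      near : ℕ
      near = ∑ μ (λ j → atMost 1 (coreδ i j))

    weight-≤1-core-∉ : ∀ i → lookup μ i ≡ outside →
                       weight (atMost 1) (core i) ≡ ind (link i i) + suc (linked μ i)
    weight-≤1-core-∉ i i∉μ = cong₂ (λ a b → a + suc b) (step-≤1 (link i i))
      (∑-update-∉ μ i (coreδ-≤1 i) i∉μ)

    linked-mono : ∀ {i j} → toℕ i ≤ toℕ j → linked μ i ≤ linked μ j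
    linked-mono i≤j = ∑-mono μ (λ k → ind-<ᵇ-mono m (+-monoˡ-≤ (suc (toℕ k)) (s≤s i≤j)))

    -- Outside `μ` the hub adds a loop that `linked` does not contain. Both summands grow with the
    -- rank, so equal sums force equal summands.
    linked-eq-∉ : ∀ i j → ind (link i i) + suc (linked μ i) ≡ ind (link j j) + suc (linked μ j) →
                  linked μ i ≡ linked μ j
    linked-eq-∉ i j eq with ≤-total (toℕ i) (toℕ j)
    ... | inj₁ i≤j = suc-injective (+-≤-≡⇒≡ (loop-mono i≤j) (s≤s (linked-mono i≤j)) eq)
    ... | inj₂ j≤i = sym (suc-injective (+-≤-≡⇒≡ (loop-mono j≤i) (s≤s (linked-mono j≤i)) (sym eq)))

    core-distinct : ∀ i j → (∀ g → weight g (core i) ≡ weight g (core j)) → i ≡ j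
    core-distinct i j eq with lookup μ i in ei | lookup μ j in ej
    ... | true  | true  = separates i j (trans ei (sym ej)) (suc-injective (suc-injective
      (trans (sym (weight-≤1-core-∈ i ei)) (trans (eq (atMost 1)) (weight-≤1-core-∈ j ej)))))
    ... | true  | false = case trans (sym (weight-≤0-core-∈ i ei)) (trans (eq (atMost 0)) (weight-≤0-core-∉ j ej)) of λ ()
    ... | false | true  = case trans (sym (weight-≤0-core-∉ i ei)) (trans (eq (atMost 0)) (weight-≤0-core-∈ j ej)) of λ ()
    ... | false | false = separates i j (trans ei (sym ej)) (linked-eq-∉ i j
      (trans (sym (weight-≤1-core-∉ i ei)) (trans (eq (atMost 1)) (weight-≤1-core-∉ j ej))))

    tail₂≢core : ∀ i → weight (atLeast 3) (tail (suc (suc zero))) ≢ weight (atLeast 3) (core i)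
    tail₂≢core i eq with () ← trans (sym (cong suc core-size)) (trans eq (weight-≥3-core i))

    tail₀≢tail₁ : weight (atLeast 2) (tail zero) ≢ weight (atLeast 2) (tail (suc zero))
    tail₀≢tail₁ eq with () ← trans (sym (cong (3 +_) core-empty)) (trans eq (cong (2 +_) core-size))

    separated : ∀ u v → (∀ g → weight g u ≡ weight g v) → number≥4 u ≡ number≥4 v → u ≡ v
    separated hub                           hub                           eq e = refl
    separated hub                           (tail (suc (suc (suc zero)))) eq ()
    separated (tail zero)                   (tail zero)                   eq e = refl
    separated (tail zero)                   (tail (suc zero))             eq e = contradiction (eq (atLeast 2)) tail₀≢tail₁
    separated (tail (suc zero))             (tail zero)                   eq e = contradiction (sym (eq (atLeast 2))) tail₀≢tail₁
    separated (tail (suc zero))             (tail (suc zero))             eq e = refl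
    separated (tail (suc (suc zero)))       (tail (suc (suc zero)))       eq e = refl
    separated (tail (suc (suc zero)))       (core j)                      eq e = contradiction (eq (atLeast 3)) (tail₂≢core j)
    separated (tail (suc (suc (suc zero)))) (tail (suc (suc (suc zero)))) eq e = refl
    separated (core i)                      (tail (suc (suc zero)))       eq e = contradiction (sym (eq (atLeast 3))) (tail₂≢core i)
    separated (core i)                      (core j)                      eq e = cong core (core-distinct i j eq)
    separated (tail zero) (tail (suc (suc (suc zero)))) eq ()
    separated (tail (suc zero)) (tail (suc (suc (suc zero)))) eq ()
    separated (tail (suc (suc zero))) (tail (suc (suc (suc zero)))) eq ()
    separated (core i) (tail (suc (suc (suc zero)))) eq ()

    weight-injective : ∀ u v → (∀ g → weight g u ≡ weight g v) → u ≡ v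
    weight-injective u v eq = separated u v eq (trans (sym (weight-≥4 u)) (trans (eq (atLeast 4)) (weight-≥4 v)))

    withCore-resolving : MultisetResolving G connected (withCore μ)
    withCore-resolving u v u≢v p = u≢v (vertex-injective (weight-injective (vertex u) (vertex v) λ g → begin
      weight g (vertex u)                              ≡⟨ ∑-cong (withCore μ) (λ w → cong g (d≡δ u w)) ⟨
      ∑ (withCore μ) (λ w → g (d G connected u w))     ≡⟨ rm-invariant G connected {u} {v} {withCore μ} p g ⟩
      ∑ (withCore μ) (λ w → g (d G connected v w))     ≡⟨ ∑-cong (withCore μ) (λ w → cong g (d≡δ v w)) ⟩
      weight g (vertex v)                              ∎))
      where open ≡-Reasoning

  -- Lower bound on the number of parts

  δ-core : ∀ i j w → (δ (core i) w ≤ 2 × δ (core j) w ≤ 2) ⊎ δ (core i) w ≡ δ (core j) w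
  δ-core i j hub      = inj₁ (step-≤2 (link i i) , step-≤2 (link j j))
  δ-core i j (tail k) = inj₂ refl
  δ-core i j (core k) = inj₁ (coreδ-≤2 i k , coreδ-≤2 j k)

  module _ {t} (S : Fin t → Subset (5 + m)) (part : IsPartition S) where
    open IsPartition part

    coord : Fin m → Fin t → ℕ
    coord i p = dSet G connected (index (core i)) (S p) (nonempty p)

    coord-≤ : ∀ i p {y} → y ∈ S p → coord i p ≤ δ (core i) (vertex y)
    coord-≤ i p {y} y∈ = ≤-trans
      (dSet-≤ G connected (index (core i)) (S p) (nonempty p) y∈)
      (≤-reflexive (d≡δ (index (core i)) y))

    coord-attained : ∀ i p → ∃ λ y → y ∈ S p × coord i p ≡ δ (core i) (vertex y)
    coord-attained i p with y , y∈ , eq ← dSet-attained G connected (index (core i)) (S p) (nonempty p) =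
      y , y∈ , trans eq (d≡δ (index (core i)) y)

    -- Take the element of the part nearest to `core i`: it is within distance 2 of both core
    -- vertices, or equidistant and then bounds the other coordinate. Exchanging `i` and `j` gives
    -- `coord-near`.
    coord-half : ∀ i j p → (coord i p ≤ 2 × coord j p ≤ 2) ⊎ coord j p ≤ coord i p
    coord-half i j p with y , y∈ , eq ← coord-attained i p with δ-core i j (vertex y)
    ... | inj₁ (δi≤2 , δj≤2) = inj₁ (≤-trans (≤-reflexive eq) δi≤2 , ≤-trans (coord-≤ j p y∈) δj≤2)
    ... | inj₂ δi≡δj         = inj₂ (≤-trans (coord-≤ j p y∈) (≤-reflexive (sym (trans eq δi≡δj))))

    coord-near : ∀ i j p → (coord i p ≤ 2 × coord j p ≤ 2) ⊎ coord i p ≡ coord j p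
    coord-near i j p with coord-half i j p | coord-half j i p
    ... | inj₁ ≤2      | _                 = inj₁ ≤2
    ... | inj₂ _       | inj₁ (j≤2 , i≤2)  = inj₁ (i≤2 , j≤2)
    ... | inj₂ j≤i     | inj₂ i≤j          = inj₂ (≤-antisym i≤j j≤i)

    zeros ones : Fin m → ℕ
    zeros i = ∑ ⊤ (λ p → ind (0 ≡ᵇ coord i p))
    ones  i = ∑ ⊤ (λ p → ind (1 ≡ᵇ coord i p))

    -- A part at distance 0 contains the vertex, and only one part does.
    zeros≡1 : ∀ i → zeros i ≡ 1
    zeros≡1 i with r , x∈ , only ← unique (index (core i)) = begin
      zeros i                                  ≡⟨ +-identityʳ _ ⟨
      zeros i + 0                              ≡⟨ ∑-update-∈ ⊤ r elsewhere (lookup-replicate r inside) ⟩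
      ∑ {t} ⊤ (λ _ → 0) + ind (0 ≡ᵇ coord i r) ≡⟨ cong₂ (λ a b → a + ind (0 ≡ᵇ b)) (∑-zero {t} ⊤ (λ _ → refl)) here≡0 ⟩
      1                                        ∎
      where
      open ≡-Reasoning
      here≡0 : coord i r ≡ 0
      here≡0 = n≤0⇒n≡0 (≤-trans (coord-≤ i r x∈) (≤-reflexive (coreδ-refl i)))
      elsewhere : ∀ p → p ≢ r → ind (0 ≡ᵇ coord i p) ≡ 0
      elsewhere p p≢r with y , y∈ , eq ← dSet-attained G connected (index (core i)) (S p) (nonempty p) =
        cong ind (≢⇒≡ᵇ-false λ 0≡ → p≢r (sym (only (subst (_∈ S p) (sym (d≡0⇒≡ G connected (sym (trans 0≡ eq)))) y∈))))

    -- One of the `t` coordinates is taken by the zero.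
    ones<t : ∀ i → ones i < t
    ones<t i = begin
      suc (ones i)       ≡⟨ cong (_+ ones i) (zeros≡1 i) ⟨
      zeros i + ones i   ≡⟨ ∑-+ ⊤ (λ p → ind (0 ≡ᵇ coord i p)) (λ p → ind (1 ≡ᵇ coord i p)) ⟨
      ∑ ⊤ (λ p → ind (0 ≡ᵇ coord i p) + ind (1 ≡ᵇ coord i p)) ≤⟨ ∑-mono ⊤ (λ p → ≤1 (coord i p)) ⟩
      ∑ {t} ⊤ (λ _ → 1)  ≡⟨ ∑-const {t} ⊤ 1 ⟩
      ∣ ⊤ {t} ∣ * 1      ≡⟨ *-identityʳ _ ⟩
      ∣ ⊤ {t} ∣          ≡⟨ ∣⊤∣≡n t ⟩
      t                  ∎
      where
      open ≤-Reasoning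
      ≤1 : ∀ x → ind (0 ≡ᵇ x) + ind (1 ≡ᵇ x) ≤ 1
      ≤1 0             = ≤-refl
      ≤1 1             = ≤-refl
      ≤1 (suc (suc x)) = z≤n

    -- With fewer than `m` parts, two core vertices have equally many ones by pigeonhole, and then
    -- equal multisets by `tabulate-↭`.
    resolving⇒m≤t : ResolvingMultisetPartition G connected S part → m ≤ t
    resolving⇒m≤t res = ≮⇒≥ λ t<m →
      case pigeonhole t<m (λ i → fromℕ< (ones<t i)) of λ (i , j , i<j , eq) →
        res (index (core i)) (index (core j))
          (λ e → <⇒≢ i<j (core-injective (trans (sym (vertex-index (core i))) (trans (cong vertex e) (vertex-index (core j))))))
          (tabulate-↭ (coord i) (coord j) (coord-near i j)
            (trans (zeros≡1 i) (sym (zeros≡1 j)))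
            (fromℕ<-injective _ _ (ones<t i) (ones<t j) eq))
      where
      core-injective : ∀ {i j} → core i ≡ core j → i ≡ j
      core-injective refl = refl

-- Choice of the parameters

linked-⊤ : ∀ m′ i → Nested.linked m′ ⊤ i ≡ suc (toℕ i)
linked-⊤ m′ i = trans (∑-threshold-⊤ (suc m′) (suc (toℕ i))) (m≥n⇒m⊓n≡n (toℕ<n i))

-- The successor form makes the core size `suc (suc (k′ * 2))` compute to `suc k′ * 2`, the length
-- of `alternate (suc k′)`.
linked-alternate : ∀ k′ i → Nested.linked (suc (k′ * 2)) (alternate (suc k′)) i ≡ ⌊ suc (toℕ i) /2⌋
linked-alternate k′ i = trans (∑-threshold-alternate (suc k′) (suc (toℕ i))) (m≥n⇒m⊓n≡n (half-≤ (suc k′) i))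

-- `W` bounds md from above and `bound` bounds mpd from below. The assumption on `⊤` provides a
-- first resolving partition, from which the search for the least one starts.
dimensions-far-apart : ∀ {n} (G : Graph n) (conn : Connected G) (W : Subset n) →
  MultisetResolving G conn W → MultisetResolving G conn ⊤ →
  ∀ N → (∀ {t} (S : Fin t → Subset n) part → ResolvingMultisetPartition G conn S part → N + ∣ W ∣ ≤ t) →
  Σ ℕ λ md → Σ ℕ λ mpd → IsMd G conn md × IsMpd G conn mpd × N ≤ ∣ mpd - md ∣
dimensions-far-apart G conn W resW res⊤ N bound =
  let md  , isMd@(_ , md≤)             = least (multisetResolving? G conn) (∣ W ∣ , W , resW , refl)
      mpd , isMpd@((S , part , res) , _) =
        least (resolvingPartition? G conn) (_ , ⁅_⁆ , singletons-resolving G conn res⊤)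
      N+md≤mpd = ≤-trans (+-monoʳ-≤ N (md≤ ∣ W ∣ (W , resW , refl))) (bound S part res)
  in md , mpd , isMd , isMpd , ≤-trans (m+n≤o⇒m≤o∸n N N+md≤mpd) (m∸n≤∣m-n∣ mpd md)

theorem2p2 : (N : ℕ) → 0 < N →
    Σ ℕ λ n → Σ (Graph n) λ G → Σ (Connected G) λ conn →
    Σ ℕ λ md → Σ ℕ λ mpd →
    IsMd G conn md × IsMpd G conn mpd × N ≤ ∣ mpd - md ∣
theorem2p2 N _ = 5 + m , G , connected ,
  dimensions-far-apart G connected (withCore (alternate k)) alternate-resolving ⊤-resolving N
    λ S part res → ≤-trans (≤-reflexive size) (resolving⇒m≤t S part res)
  where
  k m′ : ℕ
  -- The core has `2k` vertices and the resolving set `5 + k`, so the gap is at least `k - 5`, which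
  -- is `N`.
  k  = 5 + N
  m′ = suc ((4 + N) * 2)

  open Nested m′

  alternate-resolving : MultisetResolving G connected (withCore (alternate k))
  -- Here `k` is `2 + (3 + N)`, as the size hypothesis demands.
  alternate-resolving = withCore-resolving (alternate k) (3 + N) (∣alternate∣ k)
    λ i j e₁ e₂ → alternate-half-injective k i j e₁
      (trans (sym (linked-alternate (4 + N) i)) (trans e₂ (linked-alternate (4 + N) j)))

  ⊤-resolving : MultisetResolving G connected (withCore ⊤)
  -- `withCore ⊤` computes to the full vertex set; ranks alone separate its core.
  ⊤-resolving = withCore-resolving ⊤ ((4 + N) * 2) (∣⊤∣≡n m)
    λ i j _ e → toℕ-injective (suc-injective (trans (sym (linked-⊤ m′ i)) (trans e (linked-⊤ m′ j))))

  size : N + ∣ withCore (alternate k) ∣ ≡ k * 2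
  size = trans (cong (λ a → N + (5 + a)) (∣alternate∣ k)) (twice N)
    where
    twice : ∀ n → n + (5 + (5 + n)) ≡ (5 + n) * 2
    twice = solve-∀
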